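{- Let $\mathcal R$ be a left-linear TRS and let $\mathcal C$ be a critical-pair-closing system for $\mathcal R$ such that $\mathcal C_d/\mathcal R$ is terminating. If $\mathcal C$ is confluent, then $\mathcal R$ is confluent.
   Context: A TRS is a set of rules $\ell\to r$ between first-order terms, with $\ell$ not a variable and every variable of $r$ occurring in $\ell$; left-linear means that no variable occurs more than once in a left-hand side. $\to_{\mathcal R}$ is the rewrite relation, $\twoheadrightarrow_{\mathcal R}$ its reflexive-transitive closure and $\leftrightarrow^*_{\mathcal R}$ the induced convertibility. Critical pairs of $\mathcal R$ are the usual ones: for rules $\ell\to r$, $g\to d$ renamed apart, a non-variable position $p$ of $\ell$ and a most general unifier $\sigma$ of $\ell|_p$ and $g$, the pair $(r\sigma,(\ell[d]_p)\sigma)$ and its mirror image (overlaps of a rule with itself at the root are not excluded). A TRS $\mathcal C$ is critical-pair closing for $\mathcal R$ (a critical-pair-closing system for $\mathcal R$) if $\mathcal C\subseteq\mathcal R$ and $s\leftrightarrow^*_{\mathcal C}t$ for all critical pairs $(s,t)$ of $\mathcal R$. $\mathcal C_d$ is the set of all duplicating rules of $\mathcal C$, i.e. rules $\ell\to r$ in which some variable occurs more often in $r$ than in $\ell$. For TRSs $\mathcal S,\mathcal R$, $\to_{\mathcal S/\mathcal R}$ denotes $\twoheadrightarrow_{\mathcal R}\cdot\to_{\mathcal S}\cdot\twoheadrightarrow_{\mathcal R}$, and $\mathcal S/\mathcal R$ is (relatively) terminating if $\to_{\mathcal S/\mathcal R}$ is terminating. -}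

module Defs where

open import Data.Fin.Base using (Fin)
open import Data.Nat.Base using (ℕ; _+_; _≤_; _<_)
open import Data.Nat.Properties using (_≟_)
open import Data.Product.Base using (Σ-syntax; ∃; ∃-syntax; _×_; _,_; proj₁)
open import Data.Vec.Base using (Vec; []; _∷_; lookup; _[_]≔_)
open import Function.Base using (_∘_)
open import Function.Bundles using (_↔_; module Inverse)
open import Level using (Level; _⊔_) renaming (suc to lsuc)
open import Relation.Binary.Construct.Closure.Equivalence using (EqClosure)
open import Relation.Binary.Construct.Closure.ReflexiveTransitive using (Star)
open import Relation.Binary.Construct.Composition using (_;_)
open import Relation.Binary.Core using (Rel; _⇒_)
open import Relation.Binary.PropositionalEquality.Core using (_≡_)
open import Relation.Nullary.Decidable.Core using (yes; no)
open import Relation.Nullary.Negation.Core using (¬_)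

private
  variable
    o a b : Level

record Signature (o : Level) : Set (lsuc o) where
  field
    Symbol : Set o
    arity  : Symbol → ℕ

open Signature public

Var : Set
Var = ℕ

data Term (F : Signature o) : Set o where
  var : Var → Term F
  con : (f : Symbol F) → Vec (Term F) (arity F f) → Term F

module _ {F : Signature o} where

  mutual
    occ : Var → Term F → ℕ
    occ x (var y) with x ≟ y
    ... | yes _ = 1
    ... | no  _ = 0
    occ x (con f ts) = occs x ts

    occs : ∀ {n} → Var → Vec (Term F) n → ℕ
    occs x []       = 0
    occs x (t ∷ ts) = occ x t + occs x ts

  _∈Var_ : Var → Term F → Set
  x ∈Var t = 0 < occ x t

  IsVar : Term F → Set o
  IsVar t = ∃[ x ] t ≡ var x

  Linear : Term F → Set
  Linear t = ∀ x → occ x t ≤ 1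

  data Pos : Term F → Set o where
    root : ∀ {t} → Pos t
    arg  : ∀ {f ts} (i : Fin (arity F f)) → Pos (lookup ts i) → Pos (con f ts)

  _∣_ : (t : Term F) → Pos t → Term F
  t        ∣ root    = t
  con f ts ∣ arg i p = lookup ts i ∣ p

  _[_]at_ : (t : Term F) → Term F → Pos t → Term F
  t        [ u ]at root    = u
  con f ts [ u ]at arg i p = con f (ts [ i ]≔ (lookup ts i [ u ]at p))

Subst : Signature o → Set o
Subst F = Var → Term F

module _ {F : Signature o} where

  mutual
    _⟨_⟩ : Term F → Subst F → Term F
    var x    ⟨ σ ⟩ = σ x
    con f ts ⟨ σ ⟩ = con f (ts ⟨ σ ⟩*)

    _⟨_⟩* : ∀ {n} → Vec (Term F) n → Subst F → Vec (Term F) n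
    []       ⟨ σ ⟩* = []
    (t ∷ ts) ⟨ σ ⟩* = t ⟨ σ ⟩ ∷ ts ⟨ σ ⟩*

  rename : (Var ↔ Var) → Term F → Term F
  rename π t = t ⟨ var ∘ Inverse.to π ⟩

  Unifier : Term F → Term F → Subst F → Set o
  Unifier s t σ = s ⟨ σ ⟩ ≡ t ⟨ σ ⟩

  MGU : Term F → Term F → Subst F → Set o
  MGU s t σ = Unifier s t σ ×
    (∀ τ → Unifier s t τ → Σ[ δ ∈ Subst F ] ∀ x → τ x ≡ σ x ⟨ δ ⟩)

record TRS (F : Signature o) (a : Level) : Set (o ⊔ lsuc a) where
  field
    Rule    : Rel (Term F) a
    nonVar  : ∀ {ℓ r} → Rule ℓ r → ¬ IsVar ℓ
    varCond : ∀ {ℓ r} → Rule ℓ r → ∀ x → x ∈Var r → x ∈Var ℓ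

open TRS public

module _ {F : Signature o} where

  Step : TRS F a → Rel (Term F) (o ⊔ a)
  Step R s t = ∃[ ℓ ] ∃[ r ] Rule R ℓ r × Σ[ p ∈ Pos s ] Σ[ σ ∈ Subst F ]
    (s ∣ p ≡ ℓ ⟨ σ ⟩) × (t ≡ s [ r ⟨ σ ⟩ ]at p)

  LeftLinear : TRS F a → Set (o ⊔ a)
  LeftLinear R = ∀ {ℓ r} → Rule R ℓ r → Linear ℓ

  Variant : TRS F a → Rel (Term F) (o ⊔ a)
  Variant R ℓ r = ∃[ ℓ₀ ] ∃[ r₀ ] Rule R ℓ₀ r₀ ×
    Σ[ π ∈ (Var ↔ Var) ] (ℓ ≡ rename π ℓ₀) × (r ≡ rename π r₀)

  -- All renamings apart and all most general unifiers are allowed, so every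
  -- critical pair is present together with its variants.
  data CriticalPair (R : TRS F a) : Rel (Term F) (o ⊔ a) where
    pair    : ∀ {ℓ r g d} → Variant R ℓ r → Variant R g d →
              (∀ x → ¬ (x ∈Var ℓ × x ∈Var g)) →
              (p : Pos ℓ) → ¬ IsVar (ℓ ∣ p) →
              (σ : Subst F) → MGU (ℓ ∣ p) g σ →
              CriticalPair R (r ⟨ σ ⟩) ((ℓ [ d ]at p) ⟨ σ ⟩)
    mirror  : ∀ {s t} → CriticalPair R s t → CriticalPair R t s

  record CriticalPairClosing (C : TRS F a) (R : TRS F b) : Set (o ⊔ a ⊔ b) where
    field
      subset : Rule C ⇒ Rule R
      closed : CriticalPair R ⇒ EqClosure (Step C)

  Duplicating : Term F → Term F → Set
  Duplicating ℓ r = ∃[ x ] occ x ℓ < occ x r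

  duplicating : TRS F a → TRS F a
  duplicating C = record
    { Rule    = λ ℓ r → Rule C ℓ r × Duplicating ℓ r
    ; nonVar  = nonVar C ∘ proj₁
    ; varCond = varCond C ∘ proj₁
    }

  RelStep : TRS F a → TRS F b → Rel (Term F) (o ⊔ a ⊔ b)
  RelStep S R = Star (Step R) ; Step S ; Star (Step R)

{-# OPTIONS --safe #-}
module Submission where

-- Work with parallel steps ⇉ of R modulo ∼, the convertibility of C.  In a peak of parallel
-- steps a redex contracted on one side either overlaps redexes of the other side, so that a
-- critical pair closes that part up to ∼, or only has the other redexes inside its
-- substitution; hence t ⇇ s ⇉ u implies t ∼·⇉·∼·⇇·∼ u.  To get a diamond for ∼·⇉·∼, parallel
-- steps from convertible sources have to be moved to a common source, by projecting them over
-- C-steps.  A C-step that overlaps a redex allows contracting that redex first, which leaves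
-- fewer redexes; a non-overlapping non-duplicating C-step does not increase their number; and
-- a duplicating one makes the source smaller with respect to C_d/R.  So the pair of source and
-- number of redexes decreases lexicographically whenever projection needs a detour.

open import Defs
open import Algebra.Properties.CommutativeSemigroup using (interchange)
open import Data.Empty using (⊥-elim)
open import Data.Fin.Base using (Fin; zero; suc)
open import Data.Nat.Base using (ℕ; zero; suc; _+_; _*_; _∸_; _≤_; _<_; z<s; s≤s; z≤n)
open import Data.Nat.Properties
open import Data.Nat.Induction using (<-wellFounded)
open import Data.Product.Base using (Σ-syntax; ∃; ∃-syntax; _×_; _,_; proj₁; proj₂)
open import Data.Sum.Base using (_⊎_; inj₁; inj₂; [_,_]′)
open import Data.Vec.Base using (Vec; []; _∷_; lookup; _[_]≔_)
open import Data.Vec.Properties using (∷-injective)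
open import Function.Base using (_∘_; flip)
open import Function.Bundles using (_↔_; mk↔ₛ′; module Inverse)
open import Function.Construct.Identity using (↔-id)
open import Induction.WellFounded using (WellFounded; Acc; acc; module Subrelation)
open import Level using (Level; _⊔_)
open import Relation.Binary.Construct.Closure.Equivalence as Eq using (EqClosure)
open import Relation.Binary.Construct.Closure.ReflexiveTransitive as Star using (Star; ε; _◅_; _◅◅_)
open import Relation.Binary.Construct.Closure.Symmetric using (fwd; bwd)
open import Relation.Binary.Construct.Composition using (_;_)
open import Relation.Binary.Core using (Rel; _⇒_)
open import Relation.Binary.PropositionalEquality using (_≡_; refl; sym; trans; cong; cong₂; subst; subst₂)
open import Relation.Binary.Rewriting using (Confluent; StronglyNormalizing)
open import Relation.Nullary using (¬_; Dec; yes; no)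

private
  variable
    o a b : Level
    n : ℕ

-- Case distinctions, finite sums and the diamond property.

module _ {A : Set a} {P : Set b} where

  -- Substitutions and weights get glued by a decidable condition on the variable; the two laws
  -- evaluate such a gluing without unfolding the decision.
  pick : Dec P → A → A → A
  pick (yes _) x y = x
  pick (no _)  x y = y

  pick-yes : (d : Dec P) {x y : A} → P → pick d x y ≡ x
  pick-yes (yes _) _ = refl
  pick-yes (no ¬p) p = ⊥-elim (¬p p)

  pick-no : (d : Dec P) {x y : A} → ¬ P → pick d x y ≡ y
  pick-no (yes p) ¬p = ⊥-elim (¬p p)
  pick-no (no _)  _  = refl

sum : (ℕ → ℕ) → ℕ → ℕ
sum f zero    = 0
sum f (suc N) = sum f N + f N

sum-+ : ∀ f g N → sum (λ x → f x + g x) N ≡ sum f N + sum g N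
sum-+ f g zero    = refl
sum-+ f g (suc N) = trans (cong (_+ (f N + g N)) (sum-+ f g N))
  (interchange +-commutativeSemigroup (sum f N) (sum g N) (f N) (g N))

sum-cong : ∀ {f g} N → (∀ x → x < N → f x ≡ g x) → sum f N ≡ sum g N
sum-cong zero    h = refl
sum-cong (suc N) h = cong₂ _+_ (sum-cong N λ x x<N → h x (m<n⇒m<1+n x<N)) (h N ≤-refl)

sum-zero : ∀ N → sum (λ _ → 0) N ≡ 0
sum-zero zero    = refl
sum-zero (suc N) = trans (+-identityʳ _) (sum-zero N)

diamond⇒confluent : {A : Set a} {_⟶_ : Rel A b} →
                    (∀ {s t u} → s ⟶ t → s ⟶ u → ∃[ v ] (t ⟶ v) × (u ⟶ v)) → Confluent _⟶_
diamond⇒confluent {_⟶_ = _⟶_} diamond = confluent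
  where
  strip : ∀ {s t u} → s ⟶ t → Star _⟶_ s u → ∃[ v ] Star _⟶_ t v × (u ⟶ v)
  strip s⟶t ε = _ , ε , s⟶t
  strip s⟶t (s⟶u₁ ◅ u₁↠u) with diamond s⟶t s⟶u₁
  ... | _ , t⟶w , u₁⟶w with strip u₁⟶w u₁↠u
  ... | v , w↠v , u⟶v = v , t⟶w ◅ w↠v , u⟶v

  confluent : Confluent _⟶_
  confluent ε s↠u = _ , s↠u , ε
  confluent (s⟶t₁ ◅ t₁↠t) s↠u with strip s⟶t₁ s↠u
  ... | w , t₁↠w , u⟶w with confluent t₁↠t t₁↠w
  ... | v , t↠v , w↠v = v , t↠v , u⟶w ◅ w↠v

-- Variable occurrences and substitutions.

module _ {F : Signature o} where

  _∈Vars_ : Var → Vec (Term F) n → Set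
  x ∈Vars ts = 0 < occs x ts

  Linears : Vec (Term F) n → Set
  Linears ts = ∀ x → occs x ts ≤ 1

  occ-var-refl : ∀ x → occ x (var {F = F} x) ≡ 1
  occ-var-refl x with x ≟ x
  ... | yes _  = refl
  ... | no x≢x = ⊥-elim (x≢x refl)

  occ-var-≢ : ∀ {x y} → ¬ x ≡ y → occ x (var {F = F} y) ≡ 0
  occ-var-≢ {x} {y} x≢y with x ≟ y
  ... | yes x≡y = ⊥-elim (x≢y x≡y)
  ... | no _    = refl

  ∈-var : ∀ x → x ∈Var (var {F = F} x)
  ∈-var x = ≤-reflexive (sym (occ-var-refl x))

  var-∈ : ∀ {x y} → x ∈Var (var {F = F} y) → x ≡ y
  var-∈ {x} {y} x∈ with x ≟ y
  ... | yes x≡y = x≡y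
  var-∈ () | no _

  module _ {x : Var} (t : Term F) (ts : Vec (Term F) n) where

    ∈-head : x ∈Var t → x ∈Vars (t ∷ ts)
    ∈-head x∈ = ≤-trans x∈ (m≤m+n _ _)

    ∈-tail : x ∈Vars ts → x ∈Vars (t ∷ ts)
    ∈-tail x∈ = ≤-trans x∈ (m≤n+m _ (occ x t))

  ∈-lookup : ∀ {x} (ts : Vec (Term F) n) i → x ∈Var lookup ts i → x ∈Vars ts
  ∈-lookup (t ∷ ts) zero    x∈ = ∈-head t ts x∈
  ∈-lookup (t ∷ ts) (suc i) x∈ = ∈-tail t ts (∈-lookup ts i x∈)

  module _ (t : Term F) (ts : Vec (Term F) n) (lin : Linears (t ∷ ts)) where

    linear-head : Linear t
    linear-head x = ≤-trans (m≤m+n _ _) (lin x)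

    linear-tail : Linears ts
    linear-tail x = ≤-trans (m≤n+m _ (occ x t)) (lin x)

    linear-disjoint : ∀ {x} → x ∈Var t → ¬ x ∈Vars ts
    linear-disjoint {x} x∈t x∈ts = <⇒≱ (+-mono-≤ x∈t x∈ts) (lin x)

  mutual
    subst-cong : ∀ t {σ τ : Subst F} → (∀ x → x ∈Var t → σ x ≡ τ x) → t ⟨ σ ⟩ ≡ t ⟨ τ ⟩
    subst-cong (var x)    h = h x (∈-var x)
    subst-cong (con f ts) h = cong (con f) (substs-cong ts h)

    substs-cong : ∀ (ts : Vec (Term F) n) {σ τ : Subst F} →
                  (∀ x → x ∈Vars ts → σ x ≡ τ x) → ts ⟨ σ ⟩* ≡ ts ⟨ τ ⟩*
    substs-cong []       h = refl
    substs-cong (t ∷ ts) h = cong₂ _∷_ (subst-cong t λ x x∈ → h x (∈-head t ts x∈))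
                                       (substs-cong ts λ x x∈ → h x (∈-tail t ts x∈))

  mutual
    subst-compose : ∀ t (σ τ : Subst F) → t ⟨ σ ⟩ ⟨ τ ⟩ ≡ t ⟨ (λ x → σ x ⟨ τ ⟩) ⟩
    subst-compose (var x)    σ τ = refl
    subst-compose (con f ts) σ τ = cong (con f) (substs-compose ts σ τ)

    substs-compose : ∀ (ts : Vec (Term F) n) (σ τ : Subst F) →
               ts ⟨ σ ⟩* ⟨ τ ⟩* ≡ ts ⟨ (λ x → σ x ⟨ τ ⟩) ⟩*
    substs-compose []       σ τ = refl
    substs-compose (t ∷ ts) σ τ = cong₂ _∷_ (subst-compose t σ τ) (substs-compose ts σ τ)

  mutual
    subst-var : ∀ (t : Term F) → t ⟨ var ⟩ ≡ t
    subst-var (var x)    = refl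
    subst-var (con f ts) = cong (con f) (substs-var ts)

    substs-var : ∀ (ts : Vec (Term F) n) → ts ⟨ var ⟩* ≡ ts
    substs-var []       = refl
    substs-var (t ∷ ts) = cong₂ _∷_ (subst-var t) (substs-var ts)

  substs-≔ : ∀ (ts : Vec (Term F) n) i u (σ : Subst F) →
             (ts [ i ]≔ u) ⟨ σ ⟩* ≡ ts ⟨ σ ⟩* [ i ]≔ u ⟨ σ ⟩
  substs-≔ (t ∷ ts) zero    u σ = refl
  substs-≔ (t ∷ ts) (suc i) u σ = cong (t ⟨ σ ⟩ ∷_) (substs-≔ ts i u σ)

  lookup-occ : ∀ x (ts : Vec (Term F) n) i → occ x (lookup ts i) ≤ occs x ts
  lookup-occ x (t ∷ ts) zero    = m≤m+n _ _
  lookup-occ x (t ∷ ts) (suc i) = ≤-trans (lookup-occ x ts i) (m≤n+m _ (occ x t))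

  subterm-occ : ∀ x (t : Term F) (p : Pos t) → occ x (t ∣ p) ≤ occ x t
  subterm-occ x t          root      = ≤-refl
  subterm-occ x (con f ts) (arg i p) = ≤-trans (subterm-occ x (lookup ts i) p) (lookup-occ x ts i)

  mutual
    bound : Term F → ℕ
    bound (var x)    = suc x
    bound (con f ts) = bounds ts

    bounds : Vec (Term F) n → ℕ
    bounds []       = 0
    bounds (t ∷ ts) = bound t + bounds ts

  mutual
    ∈-bound : ∀ {x} (t : Term F) → x ∈Var t → x < bound t
    ∈-bound (var y) x∈ rewrite var-∈ x∈ = ≤-refl
    ∈-bound (con f ts) x∈ = ∈-bounds ts x∈

    ∈-bounds : ∀ {x} (ts : Vec (Term F) n) → x ∈Vars ts → x < bounds ts
    ∈-bounds {x = x} (t ∷ ts) x∈ with 0 <? occ x t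
    ... | yes x∈t = ≤-trans (∈-bound t x∈t) (m≤m+n _ _)
    ... | no  x∉t with occ x t
    ...   | zero  = ≤-trans (∈-bounds ts x∈) (m≤n+m _ (bound t))
    ...   | suc _ = ⊥-elim (x∉t z<s)

  -- Renamings and unification of linear terms.

  module _ (π : Var ↔ Var) where
    open Inverse π

    mutual
      occ-rename : ∀ x (t : Term F) → occ x (rename π t) ≡ occ (from x) t
      occ-rename x (var y) with x ≟ to y | from x ≟ y
      ... | yes _ | yes _ = refl
      ... | no _  | no _  = refl
      ... | yes e | no ¬e = ⊥-elim (¬e (trans (cong from e) (strictlyInverseʳ y)))
      ... | no ¬e | yes e = ⊥-elim (¬e (trans (sym (strictlyInverseˡ x)) (cong to e)))
      occ-rename x (con f ts) = occs-rename x ts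

      occs-rename : ∀ x (ts : Vec (Term F) n) → occs x (ts ⟨ var ∘ to ⟩*) ≡ occs (from x) ts
      occs-rename x []       = refl
      occs-rename x (t ∷ ts) = cong₂ _+_ (occ-rename x t) (occs-rename x ts)

  con-injective : ∀ {f g} {ts : Vec (Term F) (arity F f)} {us : Vec (Term F) (arity F g)} →
                  con f ts ≡ con g us → Σ[ e ∈ f ≡ g ] subst (Vec (Term F) ∘ arity F) e ts ≡ us
  con-injective refl = refl , refl

  -- This characterizes idempotent most general unifiers: each unifier `τ` factors through `σ` by
  -- `τ` itself. Solutions for separate arguments then glue, as no mediating substitutions have to
  -- be reconciled.
  StrongMGU : Term F → Term F → Subst F → Set o
  StrongMGU s t σ = Unifier s t σ × (∀ τ → Unifier s t τ → ∀ x → τ x ≡ σ x ⟨ τ ⟩)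

  StrongMGUs : Vec (Term F) n → Vec (Term F) n → Subst F → Set o
  StrongMGUs ss ts σ = ss ⟨ σ ⟩* ≡ ts ⟨ σ ⟩* ×
    (∀ τ → ss ⟨ τ ⟩* ≡ ts ⟨ τ ⟩* → ∀ x → τ x ≡ σ x ⟨ τ ⟩)

  Disjoint : Term F → Term F → Set
  Disjoint s t = ∀ x → ¬ (x ∈Var s × x ∈Var t)

  Disjoints : Vec (Term F) n → Vec (Term F) n → Set
  Disjoints ss ts = ∀ x → ¬ (x ∈Vars ss × x ∈Vars ts)

  _↦_ : Var → Term F → Subst F
  (x ↦ t) z = pick (z ≟ x) t (var z)

  var-mgu : ∀ x t → ¬ x ∈Var t → StrongMGU (var x) t (x ↦ t)
  var-mgu x t x∉t = trans (pick-yes (x ≟ x) refl) (sym fixed) , absorb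
    where
    fixed : t ⟨ x ↦ t ⟩ ≡ t
    fixed = trans (subst-cong t λ z z∈ → pick-no (z ≟ x) λ { refl → x∉t z∈ }) (subst-var t)

    absorb : ∀ τ → τ x ≡ t ⟨ τ ⟩ → ∀ z → τ z ≡ (x ↦ t) z ⟨ τ ⟩
    absorb τ τx≡ z with z ≟ x
    ... | yes refl = τx≡
    ... | no _     = refl

  -- Linear terms without common variables need no occurs check: the unifiers of the
  -- arguments have independent domains and are simply glued together.
  mutual
    linear-mgu : ∀ s t → Linear s → Linear t → Disjoint s t →
                 ∀ τ → Unifier s t τ → ∃ (StrongMGU s t)
    linear-mgu (var x) t _ _ dis _ _ = x ↦ t , var-mgu x t λ x∈ → dis x (∈-var x , x∈)
    linear-mgu s@(con _ _) (var y) _ _ dis _ _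
      with var-mgu y s (λ y∈ → dis y (y∈ , ∈-var y))
    ... | unif , absorb = y ↦ s , sym unif , λ τ → absorb τ ∘ sym
    linear-mgu (con f ss) (con g ts) ls lt dis τ eq with con-injective eq
    ... | refl , eq' with linear-mgus ss ts ls lt dis τ eq'
    ... | σ , unif , absorb = σ , cong (con f) unif , λ τ' e → absorb τ' (args e)
      where
      args : ∀ {us vs : Vec (Term F) (arity F f)} → con f us ≡ con f vs → us ≡ vs
      args refl = refl

    linear-mgus : ∀ (ss ts : Vec (Term F) n) → Linears ss → Linears ts → Disjoints ss ts →
                  ∀ τ → ss ⟨ τ ⟩* ≡ ts ⟨ τ ⟩* → ∃ (StrongMGUs ss ts)
    linear-mgus [] [] _ _ _ _ _ = var , refl , λ _ _ _ → refl
    linear-mgus (s ∷ ss) (t ∷ ts) ls lt dis τ eq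
      with linear-mgu s t (linear-head s ss ls) (linear-head t ts lt)
             (λ x (x∈s , x∈t) → dis x (∈-head s ss x∈s , ∈-head t ts x∈t)) τ (proj₁ (∷-injective eq))
         | linear-mgus ss ts (linear-tail s ss ls) (linear-tail t ts lt)
             (λ x (x∈s , x∈t) → dis x (∈-tail s ss x∈s , ∈-tail t ts x∈t)) τ (proj₂ (∷-injective eq))
    ... | σ₁ , unif₁ , absorb₁ | σ₂ , unif₂ , absorb₂ = σ , cong₂ _∷_ unif unifs , absorb
      where
      inHead? : ∀ x → Dec (0 < occ x s + occ x t)
      inHead? x = 0 <? occ x s + occ x t

      σ : Subst F
      σ x = pick (inHead? x) (σ₁ x) (σ₂ x)

      notInHead : ∀ {x} → ¬ x ∈Var s → ¬ x ∈Var t → ¬ 0 < occ x s + occ x t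
      notInHead {x} x∉s x∉t 0< with occ x s
      ... | zero  = x∉t 0<
      ... | suc _ = x∉s z<s

      unif : s ⟨ σ ⟩ ≡ t ⟨ σ ⟩
      unif = trans (subst-cong s λ x x∈ → pick-yes (inHead? x) (≤-trans x∈ (m≤m+n _ _)))
               (trans unif₁ (sym (subst-cong t λ x x∈ →
                 pick-yes (inHead? x) (≤-trans x∈ (m≤n+m _ (occ x s))))))

      unifs : ss ⟨ σ ⟩* ≡ ts ⟨ σ ⟩*
      unifs = trans
        (substs-cong ss λ x x∈ → pick-no (inHead? x) (notInHead
          (λ x∈s → linear-disjoint s ss ls x∈s x∈)
          (λ x∈t → dis x (∈-tail s ss x∈ , ∈-head t ts x∈t))))
        (trans unif₂ (sym (substs-cong ts λ x x∈ → pick-no (inHead? x) (notInHead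
          (λ x∈s → dis x (∈-head s ss x∈s , ∈-tail t ts x∈))
          (λ x∈t → linear-disjoint t ts lt x∈t x∈)))))

      absorb : ∀ τ → (s ∷ ss) ⟨ τ ⟩* ≡ (t ∷ ts) ⟨ τ ⟩* → ∀ x → τ x ≡ σ x ⟨ τ ⟩
      absorb τ e x with inHead? x
      ... | yes _ = absorb₁ τ (proj₁ (∷-injective e)) x
      ... | no _  = absorb₂ τ (proj₂ (∷-injective e)) x

-- Exchanges x and N + x for x < N, a bijection that renames variables below N apart.
swap : ℕ → ℕ → ℕ
swap N x with x <? N | x <? N + N
... | yes _ | _     = N + x
... | no _  | yes _ = x ∸ N
... | no _  | no _  = x

swap-below : ∀ N {x} → x < N → swap N x ≡ N + x
swap-below N {x} x<N with x <? N | x <? N + N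
... | yes _  | _ = refl
... | no x≮N | _ = ⊥-elim (x≮N x<N)

swap-above : ∀ N {x} → x < N → swap N (N + x) ≡ x
swap-above N {x} x<N with N + x <? N | N + x <? N + N
... | yes lt | _      = ⊥-elim (<⇒≱ lt (m≤m+n N x))
... | no _   | yes _  = m+n∸m≡n N x
... | no _   | no nlt = ⊥-elim (nlt (+-monoʳ-< N x<N))

swap-beyond : ∀ N {x} → N + N ≤ x → swap N x ≡ x
swap-beyond N {x} le with x <? N | x <? N + N
... | yes lt | _      = ⊥-elim (<⇒≱ lt (≤-trans (m≤m+n N N) le))
... | no _   | yes lt = ⊥-elim (<⇒≱ lt le)
... | no _   | no _   = refl

swap-involutive : ∀ N x → swap N (swap N x) ≡ x
swap-involutive N x = by-cases (x <? N) (x <? N + N)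
  where
  by-cases : Dec (x < N) → Dec (x < N + N) → swap N (swap N x) ≡ x
  by-cases (yes x<N) _ = trans (cong (swap N) (swap-below N x<N)) (swap-above N x<N)
  by-cases (no x≮N) (no x≮2N) = trans (cong (swap N) fixed) fixed
    where fixed = swap-beyond N (≮⇒≥ x≮2N)
  by-cases (no x≮N) (yes x<2N) = subst (λ y → swap N (swap N y) ≡ y) N+[x∸N]≡x
    (trans (cong (swap N) (swap-above N x∸N<N)) (swap-below N x∸N<N))
    where
    N+[x∸N]≡x : N + (x ∸ N) ≡ x
    N+[x∸N]≡x = m+[n∸m]≡n (≮⇒≥ x≮N)

    x∸N<N : x ∸ N < N
    x∸N<N = +-cancelˡ-< N _ _ (subst (_< N + N) (sym N+[x∸N]≡x) x<2N)

swapping : ℕ → ℕ ↔ ℕ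
swapping N = mk↔ₛ′ (swap N) (swap N) (swap-involutive N) (swap-involutive N)

-- Rewrite steps as structural derivations.

module _ {F : Signature o} where

  mutual
    -- Taken over a bare rule relation, this serves `R`, `C` and the duplicating rules alike.
    -- Instances enter through equations because an index `ℓ ⟨ σ ⟩` would block pattern matching.
    data _⊢_⟶_ (P : Rel (Term F) a) : Rel (Term F) (o ⊔ a) where
      root : ∀ {ℓ r s t} → P ℓ r → (σ : Subst F) → s ≡ ℓ ⟨ σ ⟩ → t ≡ r ⟨ σ ⟩ → P ⊢ s ⟶ t
      args : ∀ {f ts us} → P ⊢ ts ⟶* us → P ⊢ con f ts ⟶ con f us

    data _⊢_⟶*_ (P : Rel (Term F) a) : Rel (Vec (Term F) n) (o ⊔ a) where
      here  : ∀ {t u} {ts : Vec (Term F) n} → P ⊢ t ⟶ u → P ⊢ t ∷ ts ⟶* (u ∷ ts)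
      there : ∀ {t} {ts us : Vec (Term F) n} → P ⊢ ts ⟶* us → P ⊢ t ∷ ts ⟶* (t ∷ us)

  module _ {P : Rel (Term F) a} where

    at-index : ∀ (ts : Vec (Term F) n) i {u} → P ⊢ lookup ts i ⟶ u → P ⊢ ts ⟶* (ts [ i ]≔ u)
    at-index (t ∷ ts) zero    s = here s
    at-index (t ∷ ts) (suc i) s = there (at-index ts i s)

    mutual
      step-subst : ∀ {s t} (τ : Subst F) → P ⊢ s ⟶ t → P ⊢ s ⟨ τ ⟩ ⟶ (t ⟨ τ ⟩)
      step-subst τ (root {ℓ} {r} rule σ refl refl) =
        root rule (λ x → σ x ⟨ τ ⟩) (subst-compose ℓ σ τ) (subst-compose r σ τ)
      step-subst τ (args ss) = args (steps-subst τ ss)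

      steps-subst : ∀ {ts us : Vec (Term F) n} (τ : Subst F) →
                    P ⊢ ts ⟶* us → P ⊢ ts ⟨ τ ⟩* ⟶* (us ⟨ τ ⟩*)
      steps-subst τ (here s)   = here (step-subst τ s)
      steps-subst τ (there ss) = there (steps-subst τ ss)

  module _ {P : Rel (Term F) a} {Q : Rel (Term F) b} (P⇒Q : P ⇒ Q) where

    mutual
      step-map : ∀ {s t} → P ⊢ s ⟶ t → Q ⊢ s ⟶ t
      step-map (root rule σ e e') = root (P⇒Q rule) σ e e'
      step-map (args ss)          = args (steps-map ss)

      steps-map : ∀ {ts us : Vec (Term F) n} → P ⊢ ts ⟶* us → Q ⊢ ts ⟶* us
      steps-map (here s)   = here (step-map s)
      steps-map (there ss) = there (steps-map ss)

  module _ (R : TRS F a) where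

    fromStep : ∀ {s t} → Step R s t → Rule R ⊢ s ⟶ t
    fromStep (ℓ , r , rule , p , σ , e , refl) = go p e
      where
      go : ∀ {s} (p : Pos s) → s ∣ p ≡ ℓ ⟨ σ ⟩ → Rule R ⊢ s ⟶ (s [ r ⟨ σ ⟩ ]at p)
      go root              e = root rule σ e refl
      go (arg {ts = ts} i p) e = args (at-index ts i (go p e))

    mutual
      toStep : ∀ {s t} → Rule R ⊢ s ⟶ t → Step R s t
      toStep (root rule σ e e') = _ , _ , rule , root , σ , e , e'
      toStep (args ss) with toSteps ss
      ... | i , u , (ℓ , r , rule , p , σ , e , refl) , refl =
        ℓ , r , rule , arg i p , σ , e , refl

      toSteps : ∀ {ts us : Vec (Term F) n} → Rule R ⊢ ts ⟶* us →
                ∃[ i ] ∃[ u ] Step R (lookup ts i) u × us ≡ ts [ i ]≔ u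
      toSteps (here s) = zero , _ , toStep s , refl
      toSteps (there ss) with toSteps ss
      ... | i , u , s , refl = suc i , u , s , refl

-- Overlaps, parallel steps and redex counts.

module _ {F : Signature o} where

  -- A critical overlap before renaming apart: a redex of `ℓ ⟨ σ ⟩` rooted at a function position of
  -- `ℓ`. The inner rule may share variable names with `ℓ`, hence its own substitution `ρ`.
  record Overlap (P : Rel (Term F) a) (ℓ : Term F) (σ : Subst F) (s : Term F) : Set (o ⊔ a) where
    field
      {g d}   : Term F
      rule    : P g d
      pos     : Pos ℓ
      pattern-pos : ¬ IsVar (ℓ ∣ pos)
      ρ       : Subst F
      match   : (ℓ ∣ pos) ⟨ σ ⟩ ≡ g ⟨ ρ ⟩
      -- d' and τ stay open because the renaming and the unifier are chosen only later.
      result  : ∀ d' τ → (∀ x → x ∈Var ℓ → τ x ≡ σ x) → d' ⟨ τ ⟩ ≡ d ⟨ ρ ⟩ →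
                (ℓ [ d' ]at pos) ⟨ τ ⟩ ≡ s
      step    : P ⊢ ℓ ⟨ σ ⟩ ⟶ s

  overlap-map : {P : Rel (Term F) a} {Q : Rel (Term F) b} → P ⇒ Q →
                ∀ {ℓ σ s} → Overlap P ℓ σ s → Overlap Q ℓ σ s
  overlap-map P⇒Q ov = record
    { rule = P⇒Q rule ; pos = pos ; pattern-pos = pattern-pos ; ρ = ρ ; match = match
    ; result = result ; step = step-map P⇒Q step }
    where open Overlap ov

  mutual
    -- The index counts the contracted redexes. Nothing moves below a contracted redex, so these are
    -- parallel steps and not multisteps.
    data _⊢_⇉[_]_ (P : Rel (Term F) a) : Term F → ℕ → Term F → Set (o ⊔ a) where
      ∥var  : ∀ {x} → P ⊢ var x ⇉[ 0 ] var x
      ∥con  : ∀ {f ts us n} → P ⊢ ts ⇉*[ n ] us → P ⊢ con f ts ⇉[ n ] con f us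
      ∥rule : ∀ {ℓ r s t} → P ℓ r → (σ : Subst F) → s ≡ ℓ ⟨ σ ⟩ → t ≡ r ⟨ σ ⟩ → P ⊢ s ⇉[ 1 ] t

    data _⊢_⇉*[_]_ (P : Rel (Term F) a) : ∀ {k} → Vec (Term F) k → ℕ → Vec (Term F) k → Set (o ⊔ a) where
      []  : P ⊢ [] ⇉*[ 0 ] []
      _∷_ : ∀ {t u m k n} {ts us : Vec (Term F) k} →
            P ⊢ t ⇉[ m ] u → P ⊢ ts ⇉*[ n ] us → P ⊢ t ∷ ts ⇉*[ m + n ] (u ∷ us)

  mutual
    -- The number of redexes contracted in an instance of the term when `k x` of them are contracted
    -- at each occurrence of `x`, as in `parallel-subst`.
    weight : (Var → ℕ) → Term F → ℕ
    weight k (var x)    = k x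
    weight k (con f ts) = weights k ts

    weights : (Var → ℕ) → Vec (Term F) n → ℕ
    weights k []       = 0
    weights k (t ∷ ts) = weight k t + weights k ts

  mutual
    weight-cong : ∀ {k l} (t : Term F) → (∀ x → x ∈Var t → k x ≡ l x) → weight k t ≡ weight l t
    weight-cong (var x)    h = h x (∈-var {F = F} x)
    weight-cong (con f ts) h = weights-cong ts h

    weights-cong : ∀ {k l} (ts : Vec (Term F) n) →
                   (∀ x → x ∈Vars ts → k x ≡ l x) → weights k ts ≡ weights l ts
    weights-cong []       h = refl
    weights-cong (t ∷ ts) h = cong₂ _+_ (weight-cong t λ x x∈ → h x (∈-head t ts x∈))
                                        (weights-cong ts λ x x∈ → h x (∈-tail t ts x∈))

  mutual
    weight-sum : ∀ k (t : Term F) N → bound t ≤ N → weight k t ≡ sum (λ x → occ x t * k x) N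
    -- Only the summand at `y` has a nonzero coefficient; it lies below the top one or is the top
    -- one itself.
    weight-sum k (var y) (suc N) (s≤s y≤N) with m≤n⇒m<n∨m≡n y≤N
    ... | inj₁ y<N rewrite occ-var-≢ {F = F} {N} {y} (λ { refl → <-irrefl refl y<N }) =
      trans (weight-sum k (var y) N y<N) (sym (+-identityʳ _))
    ... | inj₂ refl rewrite occ-var-refl {F = F} y =
      sym (cong₂ _+_ (trans (sum-cong y λ x x<y → cong (_* k x)
                               (occ-var-≢ {F = F} {x} {y} λ { refl → <-irrefl refl x<y })) (sum-zero y))
                     (+-identityʳ (k y)))
    weight-sum k (con f ts) N le = weights-sum k ts N le

    weights-sum : ∀ k (ts : Vec (Term F) n) N → bounds ts ≤ N →
                  weights k ts ≡ sum (λ x → occs x ts * k x) N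
    weights-sum k []       N _  = sym (sum-zero N)
    weights-sum k (t ∷ ts) N le = trans
      (cong₂ _+_ (weight-sum k t N (≤-trans (m≤m+n _ _) le))
                 (weights-sum k ts N (≤-trans (m≤n+m _ (bound t)) le)))
      (trans (sym (sum-+ (λ x → occ x t * k x) (λ x → occs x ts * k x) N))
             (sum-cong N λ x _ → sym (*-distribʳ-+ (k x) (occ x t) (occs x ts))))

  -- Over a common range both weights are sums of `k x` with occurrence counts as coefficients. If
  -- no coefficient grows from `ℓ` to `r`, neither does the sum; one that grows exhibits a
  -- duplicated variable.
  weight-≤⊎duplicating : ∀ k ℓ r → weight k r ≤ weight k ℓ ⊎ Duplicating ℓ r
  weight-≤⊎duplicating k ℓ r
    rewrite weight-sum k ℓ (bound ℓ + bound r) (m≤m+n _ _)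
          | weight-sum k r (bound ℓ + bound r) (m≤n+m _ (bound ℓ)) = compare (bound ℓ + bound r)
    where
    compare : ∀ N → sum (λ x → occ x r * k x) N ≤ sum (λ x → occ x ℓ * k x) N ⊎ Duplicating ℓ r
    compare zero = inj₁ z≤n
    compare (suc N) with compare N | occ N r ≤? occ N ℓ
    ... | inj₂ dup | _      = inj₂ dup
    ... | inj₁ _   | no ¬le = inj₂ (N , ≰⇒> ¬le)
    ... | inj₁ le  | yes le' = inj₁ (+-mono-≤ le (*-monoˡ-≤ (k N) le'))

  module _ {P : Rel (Term F) a} where

    mutual
      parallel-refl : ∀ t → P ⊢ t ⇉[ 0 ] t
      parallel-refl (var x)    = ∥var
      parallel-refl (con f ts) = ∥con (parallels-refl ts)

      parallels-refl : ∀ (ts : Vec (Term F) n) → P ⊢ ts ⇉*[ 0 ] ts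
      parallels-refl []       = []
      parallels-refl (t ∷ ts) = parallel-refl t ∷ parallels-refl ts

    mutual
      step⇒parallel : ∀ {s t} → P ⊢ s ⟶ t → P ⊢ s ⇉[ 1 ] t
      step⇒parallel (root rule σ e e') = ∥rule rule σ e e'
      step⇒parallel (args ss)          = ∥con (steps⇒parallels ss)

      steps⇒parallels : ∀ {ss ts : Vec (Term F) n} → P ⊢ ss ⟶* ts → P ⊢ ss ⇉*[ 1 ] ts
      steps⇒parallels {ss = _ ∷ ss} (here s)   = step⇒parallel s ∷ parallels-refl ss
      steps⇒parallels {ss = s ∷ _}  (there ss) = parallel-refl s ∷ steps⇒parallels ss

    mutual
      parallel⇒steps : ∀ {s t n} → P ⊢ s ⇉[ n ] t → Star (P ⊢_⟶_) s t
      parallel⇒steps ∥var                = ε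
      parallel⇒steps (∥con ps)           = Star.gmap (con _) args (parallels⇒steps ps)
      parallel⇒steps (∥rule rule σ e e') = root rule σ e e' ◅ ε

      parallels⇒steps : ∀ {k n} {ss ts : Vec (Term F) k} → P ⊢ ss ⇉*[ n ] ts → Star (P ⊢_⟶*_) ss ts
      parallels⇒steps []       = ε
      parallels⇒steps (p ∷ ps) = Star.gmap (_∷ _) here (parallel⇒steps p) ◅◅
                                 Star.gmap (_ ∷_) there (parallels⇒steps ps)

    mutual
      parallel-subst : ∀ {k} {σ τ : Subst F} t → (∀ x → x ∈Var t → P ⊢ σ x ⇉[ k x ] τ x) →
                       P ⊢ t ⟨ σ ⟩ ⇉[ weight k t ] (t ⟨ τ ⟩)
      parallel-subst (var x)    h = h x (∈-var {F = F} x)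
      parallel-subst (con f ts) h = ∥con (parallels-subst ts h)

      parallels-subst : ∀ {k} {σ τ : Subst F} (ts : Vec (Term F) n) →
                        (∀ x → x ∈Vars ts → P ⊢ σ x ⇉[ k x ] τ x) →
                        P ⊢ ts ⟨ σ ⟩* ⇉*[ weights k ts ] (ts ⟨ τ ⟩*)
      parallels-subst []       h = []
      parallels-subst (t ∷ ts) h = parallel-subst t (λ x x∈ → h x (∈-head t ts x∈)) ∷
                                   parallels-subst ts (λ x x∈ → h x (∈-tail t ts x∈))

    -- Decomposing parallel steps along linear patterns.

    Overlaps : Vec (Term F) n → Subst F → Vec (Term F) n → Set _
    Overlaps ts σ ss = ∃[ i ] ∃[ s ] Overlap P (lookup ts i) σ s × ss ≡ ts ⟨ σ ⟩* [ i ]≔ s ×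
                                     P ⊢ ts ⟨ σ ⟩* ⟶* ss

    overlap-root : ∀ {f ts g d σ} → P g d → (ρ : Subst F) → con f ts ⟨ σ ⟩ ≡ g ⟨ ρ ⟩ →
                   Overlap P (con f ts) σ (d ⟨ ρ ⟩)
    overlap-root rule ρ e = record
      { rule = rule ; pos = root ; pattern-pos = λ { (_ , ()) } ; ρ = ρ ; match = e
      ; result = λ _ _ _ e' → e' ; step = root rule ρ e refl }

    overlap-con : ∀ {f ts σ ss} → Overlaps ts σ ss → Overlap P (con f ts) σ (con f ss)
    overlap-con {f} {ts} (i , s , ov , refl , steps) = record
      { rule = rule ; pos = arg i pos ; pattern-pos = pattern-pos ; ρ = ρ ; match = match
      ; result = λ d' τ agree e → cong (con f) (trans (substs-≔ ts i _ τ)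
          (cong₂ (_[ i ]≔_) (substs-cong ts agree)
                 (result d' τ (λ x x∈ → agree x (∈-lookup ts i x∈)) e)))
      ; step = args steps }
      where open Overlap ov

    -- Either all redexes lie in the substitution, or one of them overlaps `ℓ`; that one is then
    -- contracted in advance, leaving fewer for the rest of the step.
    data Decomposition (ℓ : Term F) (σ : Subst F) (n : ℕ) (t : Term F) : Set (o ⊔ a) where
      inside  : ∀ τ k → (∀ x → x ∈Var ℓ → P ⊢ σ x ⇉[ k x ] τ x) →
                t ≡ ℓ ⟨ τ ⟩ → weight k ℓ ≡ n → Decomposition ℓ σ n t
      overlapping : ∀ {s m} → Overlap P ℓ σ s → P ⊢ s ⇉[ m ] t → m < n → Decomposition ℓ σ n t

    data Decompositions {j} (ℓs : Vec (Term F) j) (σ : Subst F) (n : ℕ) (ts : Vec (Term F) j) :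
                        Set (o ⊔ a) where
      inside  : ∀ τ k → (∀ x → x ∈Vars ℓs → P ⊢ σ x ⇉[ k x ] τ x) →
                ts ≡ ℓs ⟨ τ ⟩* → weights k ℓs ≡ n → Decompositions ℓs σ n ts
      overlapping : ∀ {ss m} → Overlaps ℓs σ ss → P ⊢ ss ⇉*[ m ] ts → m < n → Decompositions ℓs σ n ts

    mutual
      -- Descend along `ℓ`: a redex met at a function position overlaps, and what happens at a
      -- variable goes into `τ`. By linearity different arguments constrain disjoint sets of
      -- variables, so their substitutions and counts glue.
      decompose : ∀ ℓ {σ n t} → Linear ℓ → P ⊢ ℓ ⟨ σ ⟩ ⇉[ n ] t → Decomposition ℓ σ n t
      -- Constant functions do, since only their values at `x` are consulted.
      decompose (var x) {σ} {n} {t} _ p =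
        inside (λ _ → t) (λ _ → n) (λ y y∈ → subst (λ z → P ⊢ σ z ⇉[ n ] t) (sym (var-∈ {F = F} y∈)) p)
               refl refl
      decompose (con f ℓs) lin (∥rule rule ρ e refl) =
        overlapping (overlap-root rule ρ e) (parallel-refl _) z<s
      decompose (con f ℓs) lin (∥con ps) with decomposes ℓs lin ps
      ... | inside τ k h refl e  = inside τ k h refl e
      ... | overlapping ovs ps' m<n = overlapping (overlap-con ovs) (∥con ps') m<n

      decomposes : ∀ {j} (ℓs : Vec (Term F) j) {σ n ts} → Linears ℓs →
                   P ⊢ ℓs ⟨ σ ⟩* ⇉*[ n ] ts → Decompositions ℓs σ n ts
      decomposes [] lin [] = inside var (λ _ → 0) (λ _ ()) refl refl
      decomposes (ℓ ∷ ℓs) {σ} lin (p ∷ ps)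
        with decompose ℓ (linear-head ℓ ℓs lin) p | decomposes ℓs (linear-tail ℓ ℓs lin) ps
      ... | overlapping ov p' m<n | _ =
        overlapping (zero , _ , ov , refl , here (Overlap.step ov)) (p' ∷ ps) (+-monoˡ-< _ m<n)
      ... | inside _ _ _ _ _ | overlapping (i , s , ov , refl , steps) ps' m<n =
        overlapping (suc i , s , ov , refl , there steps) (p ∷ ps') (+-monoʳ-< _ m<n)
      ... | inside τ₁ k₁ h₁ refl refl | inside τ₂ k₂ h₂ refl refl =
        inside τ k h
          (cong₂ _∷_ (subst-cong ℓ λ x x∈ → sym (pick-yes (inHead? x) x∈))
                     (substs-cong ℓs λ x x∈ → sym (pick-no (inHead? x) (notInHead x∈))))
          (cong₂ _+_ (weight-cong ℓ λ x x∈ → pick-yes (inHead? x) x∈)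
                     (weights-cong ℓs λ x x∈ → pick-no (inHead? x) (notInHead x∈)))
        where
        inHead? : ∀ x → Dec (x ∈Var ℓ)
        inHead? x = 0 <? occ x ℓ

        notInHead : ∀ {x} → x ∈Vars ℓs → ¬ x ∈Var ℓ
        notInHead = flip (linear-disjoint ℓ ℓs lin)

        τ : Subst F
        τ x = pick (inHead? x) (τ₁ x) (τ₂ x)

        k : Var → ℕ
        k x = pick (inHead? x) (k₁ x) (k₂ x)

        h : ∀ x → x ∈Vars (ℓ ∷ ℓs) → P ⊢ σ x ⇉[ k x ] τ x
        h x x∈ with inHead? x
        ... | yes x∈ℓ = h₁ x x∈ℓ
        ... | no x∉ℓ  = h₂ x (subst (λ m → 0 < m + occs x ℓs) (n<1⇒n≡0 (≰⇒> x∉ℓ)) x∈)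

  -- Closing overlaps by critical pairs.

  module _ {R : TRS F a} {C : TRS F b} (linear : LeftLinear R) (cpc : CriticalPairClosing C R) where
    open CriticalPairClosing cpc

    -- After renaming `g` apart, `σ` and `ρ` merge into one unifier `τ`, so linearity yields a most
    -- general unifier `μ` and with it a critical pair. Instantiating its `C`-conversion by `τ`
    -- gives the two terms wanted, because `τ` absorbs `μ`.
    overlap-closed : ∀ {ℓ r σ s} → Rule R ℓ r → Overlap (Rule R) ℓ σ s →
                     EqClosure (Rule C ⊢_⟶_) (r ⟨ σ ⟩) s
    overlap-closed {ℓ} {r} {σ} {s} ruleℓ ov =
      subst₂ (EqClosure _) left right (Eq.gmap (_⟨ τ ⟩) (step-subst τ ∘ fromStep C) (closed critical))
      where
      open Overlap ov
      N : ℕ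
      N = bound ℓ + bound g

      ℓ<N : ∀ {x} → x ∈Var ℓ → x < N
      ℓ<N x∈ = ≤-trans (∈-bound ℓ x∈) (m≤m+n _ _)

      g<N : ∀ {x} → x ∈Var g → x < N
      g<N x∈ = ≤-trans (∈-bound g x∈) (m≤n+m _ (bound ℓ))

      π : Var ↔ Var
      π = swapping N

      disjoint : ∀ x → ¬ (x ∈Var ℓ × x ∈Var rename π g)
      disjoint x (x∈ℓ , x∈g) = <⇒≱ (g<N (subst (0 <_) (occ-rename π x g) x∈g))
        (subst (N ≤_) (sym (swap-below N (ℓ<N x∈ℓ))) (m≤m+n N x))

      linear-g : Linear (rename π g)
      linear-g x = subst (_≤ 1) (sym (occ-rename π x g)) (linear rule _)

      τ : Subst F
      -- All variables of `ℓ` lie below `N`, and a variable `x` of `g` has become `N + x`.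
      τ x = pick (x <? N) (σ x) (ρ (x ∸ N))

      τ-ℓ : ∀ x → x ∈Var ℓ → τ x ≡ σ x
      τ-ℓ x x∈ = pick-yes (x <? N) (ℓ<N x∈)

      τ-rename : ∀ t → (∀ x → x ∈Var t → x ∈Var g) → rename π t ⟨ τ ⟩ ≡ t ⟨ ρ ⟩
      τ-rename t vars = trans (subst-compose t _ τ) (subst-cong t λ x x∈ →
        trans (cong τ (swap-below N (g<N (vars x x∈))))
        (trans (pick-no (N + x <? N) (m+n≮m N x)) (cong ρ (m+n∸m≡n N x))))

      unifiable : Unifier (ℓ ∣ pos) (rename π g) τ
      unifiable = trans (subst-cong (ℓ ∣ pos) λ x x∈ → τ-ℓ x (≤-trans x∈ (subterm-occ x ℓ pos)))
        (trans match (sym (τ-rename g λ _ x∈ → x∈)))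

      mgu : ∃ (StrongMGU (ℓ ∣ pos) (rename π g))
      mgu = linear-mgu (ℓ ∣ pos) (rename π g)
        (λ x → ≤-trans (subterm-occ x ℓ pos) (linear ruleℓ x)) linear-g
        (λ x (x∈ℓ , x∈g) → disjoint x (≤-trans x∈ℓ (subterm-occ x ℓ pos) , x∈g)) τ unifiable

      μ : Subst F
      μ = proj₁ mgu

      absorb : ∀ υ → Unifier (ℓ ∣ pos) (rename π g) υ → ∀ x → υ x ≡ μ x ⟨ υ ⟩
      absorb = proj₂ (proj₂ mgu)

      critical : CriticalPair R (r ⟨ μ ⟩) ((ℓ [ rename π d ]at pos) ⟨ μ ⟩)
      critical = pair (_ , _ , ruleℓ , ↔-id Var , sym (subst-var ℓ) , sym (subst-var r))
        (_ , _ , rule , π , refl , refl) disjoint pos pattern-pos μ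
        (proj₁ (proj₂ mgu) , λ υ unif → υ , absorb υ unif)

      μτ : ∀ t → t ⟨ μ ⟩ ⟨ τ ⟩ ≡ t ⟨ τ ⟩
      μτ t = trans (subst-compose t μ τ) (subst-cong t λ x _ → sym (absorb τ unifiable x))

      left : r ⟨ μ ⟩ ⟨ τ ⟩ ≡ r ⟨ σ ⟩
      left = trans (μτ r) (subst-cong r λ x x∈ → τ-ℓ x (varCond R ruleℓ x x∈))

      right : (ℓ [ rename π d ]at pos) ⟨ μ ⟩ ⟨ τ ⟩ ≡ s
      right = trans (μτ (ℓ [ rename π d ]at pos))
        (result (rename π d) τ τ-ℓ (τ-rename d (varCond R rule)))

-- Conversion in `C` and projection over a single `C`-step.

module Confluence {F : Signature o} (R : TRS F a) (C : TRS F b) (linear : LeftLinear R)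
                  (cpc : CriticalPairClosing C R)
                  (terminating : StronglyNormalizing (RelStep (duplicating C) R))
                  (C-confluent : Confluent (Step C)) where
  open CriticalPairClosing cpc using (subset)

  infix 4 _⟶R_ _↠R_ _⟶C_ _↠C_ _∼_ _⟶D_ _⟶D/R_ _∼*_ _⇉[_]_ _⇉*[_]_ _≺_ _≼_ _⇛_ _⇛*_

  _⟶R_ _↠R_ : Rel (Term F) (o ⊔ a)
  _⟶R_ = Rule R ⊢_⟶_
  _↠R_ = Star _⟶R_

  _⟶C_ _↠C_ _∼_ _⟶D_ : Rel (Term F) (o ⊔ b)
  _⟶C_ = Rule C ⊢_⟶_
  _↠C_ = Star _⟶C_
  _∼_  = EqClosure _⟶C_
  _⟶D_ = Rule (duplicating C) ⊢_⟶_

  _∼*_ : Rel (Vec (Term F) n) (o ⊔ b)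
  _∼*_ = EqClosure (Rule C ⊢_⟶*_)

  _⇉[_]_ : Term F → ℕ → Term F → Set (o ⊔ a)
  _⇉[_]_ = Rule R ⊢_⇉[_]_

  _⇉*[_]_ : Vec (Term F) n → ℕ → Vec (Term F) n → Set (o ⊔ a)
  _⇉*[_]_ = Rule R ⊢_⇉*[_]_

  ∼-sym : ∀ {s t} → s ∼ t → t ∼ s
  ∼-sym = Eq.symmetric _

  ↠C⇒∼ : ∀ {s t} → s ↠C t → s ∼ t
  ↠C⇒∼ = Star.map fwd

  C⇒R : ∀ {s t} → s ⟶C t → s ⟶R t
  C⇒R = step-map subset

  ↠C⇒↠R : ∀ {s t} → s ↠C t → s ↠R t
  ↠C⇒↠R = Star.map C⇒R

  ∼-con : ∀ {f} {ts us : Vec (Term F) (arity F f)} → ts ∼* us → con f ts ∼ con f us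
  ∼-con = Eq.gmap (con _) args

  ∼*-∷ : ∀ {t u} {ts us : Vec (Term F) n} → t ∼ u → ts ∼* us → (t ∷ ts) ∼* (u ∷ us)
  ∼*-∷ t∼u ts∼us = Eq.gmap (_∷ _) here t∼u ◅◅ Eq.gmap (_ ∷_) there ts∼us

  -- Confluence of `C` enters here: a backward step together with the join found so far is a peak of
  -- `C`.
  church-rosser : ∀ {s t} → s ∼ t → ∃[ u ] s ↠C u × t ↠C u
  church-rosser ε = _ , ε , ε
  church-rosser (fwd s⟶ ◅ conv) with church-rosser conv
  ... | u , ↠u , t↠u = u , s⟶ ◅ ↠u , t↠u
  church-rosser (bwd ⟶s ◅ conv) with church-rosser conv
  ... | u , ↠u , t↠u with C-confluent (toStep C ⟶s ◅ ε) (Star.map (toStep C) ↠u)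
  ... | v , s↠v , u↠v = v , Star.map (fromStep C) s↠v , t↠u ◅◅ Star.map (fromStep C) u↠v

  -- In the second case a redex of the parallel step overlaps the C-step; contracting that
  -- redex first makes up for the C-step, by closure of the critical pair.
  data Local {A : Set o} (_⟶R_ : Rel A (o ⊔ a)) (_⟶C_ _⟶D_ : Rel A (o ⊔ b))
             (_⇉[_]_ : A → ℕ → A → Set (o ⊔ a)) (s s' : A) (n : ℕ) (t : A) : Set (o ⊔ a ⊔ b) where
    project : ∀ {m t'} → s' ⇉[ m ] t' → EqClosure _⟶C_ t' t → m ≤ n ⊎ s ⟶D s' →
              Local _⟶R_ _⟶C_ _⟶D_ _⇉[_]_ s s' n t
    absorb  : ∀ {m u} → Star _⟶R_ s u → u ⇉[ m ] t → m < n → EqClosure _⟶C_ u s' →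
              Local _⟶R_ _⟶C_ _⟶D_ _⇉[_]_ s s' n t

  Local₁ : Term F → Term F → ℕ → Term F → Set (o ⊔ a ⊔ b)
  Local₁ = Local _⟶R_ _⟶C_ _⟶D_ _⇉[_]_

  Local* : Vec (Term F) n → Vec (Term F) n → ℕ → Vec (Term F) n → Set (o ⊔ a ⊔ b)
  Local* = Local (Rule R ⊢_⟶*_) (Rule C ⊢_⟶*_) (Rule (duplicating C) ⊢_⟶*_) _⇉*[_]_

  mutual
    -- A side that contracts at the root supplies the pattern along which the other side is
    -- decomposed; if neither does, the question passes to the argument containing the `C`-step.
    local : ∀ {s s' n t} → s ⇉[ n ] t → s ⟶C s' → Local₁ s s' n t
    local p (root {ℓ} {r} rule σ refl refl) with decompose ℓ (linear (subset rule)) p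
    ... | overlapping ov p' m<n =
      absorb (Overlap.step ov ◅ ε) p' m<n (∼-sym (overlap-closed linear cpc (subset rule) ov))
    -- The target `ℓ ⟨ τ ⟩` is one `C`-step before the projected target `r ⟨ τ ⟩`; the redexes are
    -- copied as often as `r` repeats their variables.
    ... | inside τ k h refl refl = project
      (parallel-subst r λ x x∈ → h x (varCond C rule x x∈))
      (bwd (root rule τ refl refl) ◅ ε) small
      where
      small : weight k r ≤ weight k ℓ ⊎ ℓ ⟨ σ ⟩ ⟶D r ⟨ σ ⟩
      small with weight-≤⊎duplicating k ℓ r
      ... | inj₁ le  = inj₁ le
      ... | inj₂ dup = inj₂ (root (rule , dup) σ refl refl)
    local (∥con ps) (args ss) with locals ps ss
    ... | project ps' conv (inj₁ m≤n) = project (∥con ps') (∼-con conv) (inj₁ m≤n)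
    ... | project ps' conv (inj₂ dup) = project (∥con ps') (∼-con conv) (inj₂ (args dup))
    ... | absorb steps ps' m<n conv   = absorb (Star.gmap (con _) args steps) (∥con ps') m<n (∼-con conv)
    -- The `C`-step counts as a parallel step with one redex, to be decomposed along the left-hand
    -- side of the `R`-rule.
    local {s' = s'} (∥rule {ℓ} {r} rule σ s≡ refl) s⟶s'@(args _)
      with decompose ℓ (linear rule) (subst (λ s → Rule C ⊢ s ⇉[ 1 ] s') s≡ (step⇒parallel s⟶s'))
    ... | inside τ k h s'≡ _ = project (∥rule rule τ s'≡ refl)
      (∼-sym (↠C⇒∼ (parallel⇒steps (parallel-subst r λ x x∈ → h x (varCond R rule x x∈)))))
      (inj₁ ≤-refl)
    -- The root contraction is the whole parallel step, so the empty step remains.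
    ... | overlapping ov p _ = absorb (root rule σ s≡ refl ◅ ε) (parallel-refl _) z<s
      (overlap-closed linear cpc rule (overlap-map subset ov) ◅◅ ↠C⇒∼ (parallel⇒steps p))

    locals : ∀ {j n} {ss ss' ts : Vec (Term F) j} → ss ⇉*[ n ] ts → Rule C ⊢ ss ⟶* ss' →
             Local* ss ss' n ts
    locals (p ∷ ps) (here s) with local p s
    ... | project p' conv (inj₁ m≤n) = project (p' ∷ ps) (∼*-∷ conv ε) (inj₁ (+-monoˡ-≤ _ m≤n))
    ... | project p' conv (inj₂ dup) = project (p' ∷ ps) (∼*-∷ conv ε) (inj₂ (here dup))
    ... | absorb steps p' m<n conv   =
      absorb (Star.gmap (_∷ _) here steps) (p' ∷ ps) (+-monoˡ-< _ m<n) (∼*-∷ conv ε)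
    locals (p ∷ ps) (there s) with locals ps s
    ... | project ps' conv (inj₁ m≤n) = project (p ∷ ps') (∼*-∷ ε conv) (inj₁ (+-monoʳ-≤ _ m≤n))
    ... | project ps' conv (inj₂ dup) = project (p ∷ ps') (∼*-∷ ε conv) (inj₂ (there dup))
    ... | absorb steps ps' m<n conv   =
      absorb (Star.gmap (_ ∷_) there steps) (p ∷ ps') (+-monoʳ-< _ m<n) (∼*-∷ ε conv)

  -- Labels and projection over `C`-reductions.

  Label : Set o
  Label = Term F × ℕ

  _⟶D/R_ : Rel (Term F) (o ⊔ a ⊔ b)
  _⟶D/R_ = _↠R_ ; _⟶D_ ; _↠R_

  -- Lexicographic, except that `R`-steps on the term are free as long as the count drops. In `≼`
  -- the `suc` turns the strict comparison of counts into a weak one.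
  _≺_ _≼_ : Rel Label (o ⊔ a ⊔ b)
  (t , m) ≺ (s , n) = s ⟶D/R t ⊎ s ↠R t × m < n
  q ≼ (s , n) = q ≺ (s , suc n)

  ↠R-⟶D/R : ∀ {s t u} → s ↠R t → t ⟶D/R u → s ⟶D/R u
  ↠R-⟶D/R s↠t (_ , t↠ , d , ↠u) = _ , s↠t ◅◅ t↠ , d , ↠u

  ⟶D/R-↠R : ∀ {s t u} → s ⟶D/R t → t ↠R u → s ⟶D/R u
  ⟶D/R-↠R (_ , s↠ , _ , d , ↠t) t↠u = _ , s↠ , _ , d , ↠t ◅◅ t↠u

  ⟶D/R⇒↠R : ∀ {s t} → s ⟶D/R t → s ↠R t
  ⟶D/R⇒↠R (_ , s↠ , _ , d , ↠t) = s↠ ◅◅ step-map (subset ∘ proj₁) d ◅ ↠t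

  ≺-≼-trans : ∀ {p q r} → p ≺ q → q ≼ r → p ≺ r
  ≺-≼-trans (inj₁ t⟶u)         (inj₁ s⟶t)             = inj₁ (↠R-⟶D/R (⟶D/R⇒↠R s⟶t) t⟶u)
  ≺-≼-trans (inj₁ t⟶u)         (inj₂ (s↠t , _))       = inj₁ (↠R-⟶D/R s↠t t⟶u)
  ≺-≼-trans (inj₂ (t↠u , _))   (inj₁ s⟶t)             = inj₁ (⟶D/R-↠R s⟶t t↠u)
  ≺-≼-trans (inj₂ (t↠u , m<k)) (inj₂ (s↠t , s≤s k≤n)) = inj₂ (s↠t ◅◅ t↠u , ≤-trans m<k k≤n)

  ≺⇒≼ : ∀ {p q} → p ≺ q → p ≼ q
  ≺⇒≼ (inj₁ d)           = inj₁ d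
  ≺⇒≼ (inj₂ (s↠t , m<n)) = inj₂ (s↠t , m<n⇒m<1+n m<n)

  -- Raising the smaller count weakens `≺` to `≼`. Since `≼` is itself `≺` with a raised count, the
  -- next two laws become instances of `≺-≼-trans`.
  ≺-suc : ∀ {t m s n} → (t , m) ≺ (s , n) → (t , suc m) ≼ (s , n)
  ≺-suc (inj₁ d)           = inj₁ d
  ≺-suc (inj₂ (s↠t , m<n)) = inj₂ (s↠t , s≤s m<n)

  ≼-trans : ∀ {p q r} → p ≼ q → q ≼ r → p ≼ r
  ≼-trans p≼q q≼r = ≺-≼-trans p≼q (≺-suc q≼r)

  ≼-≺-trans : ∀ {p q r} → p ≼ q → q ≺ r → p ≺ r
  ≼-≺-trans p≼q q≺r = ≺-≼-trans p≼q (≺-suc q≺r)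

  -- Nested induction on `⟶D/R` and on the count. Accessibility is kept for a term `s` from which
  -- the current term is `R`-reachable; these `R`-steps are absorbed into the next relative step.
  ≺-wellFounded : WellFounded _≺_
  ≺-wellFounded (s , n) = go (wf s) (<-wellFounded n) ε
    where
    wf : WellFounded (flip _⟶D/R_)
    wf = Subrelation.wellFounded
      (λ (_ , s↠ , _ , d , ↠t) → _ , Star.map (toStep R) s↠ ,
                               _ , toStep (duplicating C) d , Star.map (toStep R) ↠t)
      terminating

    mutual
      go : ∀ {s n t} → Acc (flip _⟶D/R_) s → Acc _<_ n → s ↠R t → Acc _≺_ (t , n)
      go acc-s acc-n s↠t = acc λ {q} → below acc-s acc-n s↠t {q}

      below : ∀ {s n t} → Acc (flip _⟶D/R_) s → Acc _<_ n → s ↠R t →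
              ∀ {q} → q ≺ (t , n) → Acc _≺_ q
      below (acc hs) _ s↠t (inj₁ t⟶u)             = go (hs (↠R-⟶D/R s↠t t⟶u)) (<-wellFounded _) ε
      below acc-s (acc hn) s↠t (inj₂ (t↠u , m<n)) = go acc-s (hn m<n) (s↠t ◅◅ t↠u)

  -- The detour from u to x cannot be avoided: a C-step may erase redexes that reappear
  -- only after further C-steps, but then an overlap or a duplication has been used up.
  record Projection (q : Label) (u t : Term F) : Set (o ⊔ a ⊔ b) where
    constructor projection
    field
      {size}   : ℕ
      {x t'}   : Term F
      u↠x      : u ↠C x
      parallel : x ⇉[ size ] t'
      t'∼t     : t' ∼ t
      smaller  : (x ≡ u × (x , size) ≼ q) ⊎ (x , size) ≺ q

  -- Outer induction on the label, inner on the `C`-reduction. A projected step advances along the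
  -- reduction with a label that is not larger, so the outer hypothesis stays available; an absorbed
  -- one leaves the reduction for a smaller label.
  project-along : ∀ {s n t u} → Acc _≺_ (s , n) → s ⇉[ n ] t → s ↠C u → Projection (s , n) u t
  project-along (acc rec) = go λ q≺ → project-along (rec q≺)
    where
    go : ∀ {s n t u} →
         (∀ {v m t u} → (v , m) ≺ (s , n) → v ⇉[ m ] t → v ↠C u → Projection (v , m) u t) →
         s ⇉[ n ] t → s ↠C u → Projection (s , n) u t
    go ih p ε = projection ε p ε (inj₁ (refl , inj₂ (ε , ≤-refl)))
    go {s} {n} {t} {u} ih p (_◅_ {j = s'} s⟶s' s'↠u) with local p s⟶s'
    -- Being convertible, `v` and `u` reach a common `y` in `C`. Projecting from `v` towards `y`
    -- starts at a strictly smaller label, which pays for the detour from `u` to `y`.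
    ... | absorb {m} {v} s↠v p' m<n v∼s' = further (church-rosser (v∼s' ◅◅ ↠C⇒∼ s'↠u))
      where
      v≺s : (v , m) ≺ (s , n)
      v≺s = inj₂ (s↠v , m<n)

      further : ∃[ y ] v ↠C y × u ↠C y → Projection (s , n) u t
      further (_ , v↠y , u↠y) with ih v≺s p' v↠y
      ... | projection y↠x p'' conv (inj₁ (_ , q≼)) =
        projection (u↠y ◅◅ y↠x) p'' conv (inj₂ (≼-≺-trans q≼ v≺s))
      ... | projection y↠x p'' conv (inj₂ q≺) =
        projection (u↠y ◅◅ y↠x) p'' conv (inj₂ (≺-≼-trans q≺ (≺⇒≼ v≺s)))
    ... | project {m} {t'} p' t'∼t small = lift (go (λ q≺ → ih (≺-≼-trans q≺ s'≼s)) p' s'↠u)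
      where
      s'≼s : (s' , m) ≼ (s , n)
      s'≼s = [ (λ m≤n → inj₂ (C⇒R s⟶s' ◅ ε , s≤s m≤n)) , (λ dup → inj₁ (_ , ε , _ , dup , ε)) ]′ small

      lift : Projection (s' , m) u t' → Projection (s , n) u t
      lift (projection u↠x p'' conv (inj₁ (e , q≼))) =
        projection u↠x p'' (conv ◅◅ t'∼t) (inj₁ (e , ≼-trans q≼ s'≼s))
      lift (projection u↠x p'' conv (inj₂ q≺)) =
        projection u↠x p'' (conv ◅◅ t'∼t) (inj₂ (≺-≼-trans q≺ s'≼s))

  -- Alternately project one step along the other's detour; every detour decreases a label.
  synchronize : ∀ {p m q k t u} → Acc _≺_ (p , m) → Acc _≺_ (q , k) →
                p ↠C q → p ⇉[ m ] t → q ⇉[ k ] u →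
                ∃[ x ] ∃[ m' ] ∃[ k' ] ∃[ t' ] ∃[ u' ]
                  x ⇉[ m' ] t' × t' ∼ t × x ⇉[ k' ] u' × u' ∼ u
  synchronize acc-p@(acc rec) acc-q p↠q p⇉t q⇉u with project-along acc-p p⇉t p↠q
  ... | projection _ x⇉t' t'∼t (inj₁ (refl , _)) = _ , _ , _ , _ , _ , x⇉t' , t'∼t , q⇉u , ε
  ... | projection q↠x x⇉t' t'∼t (inj₂ x≺p) with synchronize acc-q (rec x≺p) q↠x q⇉u x⇉t'
  ...   | _ , _ , _ , _ , _ , y⇉u' , u'∼u , y⇉t'' , t''∼t' =
    _ , _ , _ , _ , _ , y⇉t'' , t''∼t' ◅◅ t'∼t , y⇉u' , u'∼u

  -- The diamond property modulo `∼` and confluence.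

  _⇛_ : Rel (Term F) (o ⊔ a ⊔ b)
  s ⇛ t = ∃[ s' ] ∃[ n ] ∃[ t' ] s ∼ s' × s' ⇉[ n ] t' × t' ∼ t

  _⇛*_ : Rel (Vec (Term F) n) (o ⊔ a ⊔ b)
  ss ⇛* ts = ∃[ ss' ] ∃[ n ] ∃[ ts' ] ss ∼* ss' × ss' ⇉*[ n ] ts' × ts' ∼* ts

  ∼⇒⇛ : ∀ {s t} → s ∼ t → s ⇛ t
  ∼⇒⇛ s∼t = _ , _ , _ , s∼t , parallel-refl _ , ε

  ⇉⇒⇛ : ∀ {s t n} → s ⇉[ n ] t → s ⇛ t
  ⇉⇒⇛ p = _ , _ , _ , ε , p , ε

  ⇛-con : ∀ {f} {ts us : Vec (Term F) (arity F f)} → ts ⇛* us → con f ts ⇛ con f us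
  ⇛-con (_ , _ , _ , l , p , r) = _ , _ , _ , ∼-con l , ∥con p , ∼-con r

  ⇛*-∷ : ∀ {t u} {ts us : Vec (Term F) n} → t ⇛ u → ts ⇛* us → (t ∷ ts) ⇛* (u ∷ us)
  ⇛*-∷ (_ , _ , _ , l , p , r) (_ , _ , _ , ls , ps , rs) =
    _ , _ , _ , ∼*-∷ l ls , p ∷ ps , ∼*-∷ r rs

  -- With an overlap, `u` itself closes the peak: `r ⟨ σ ⟩` is convertible to the term from which
  -- the rest of the parallel step leads to `u`. Otherwise the rule commutes with the steps inside
  -- its substitution.
  peak-root : ∀ {ℓ r s m u} → Rule R ℓ r → (σ : Subst F) → s ≡ ℓ ⟨ σ ⟩ → s ⇉[ m ] u →
              ∃[ v ] r ⟨ σ ⟩ ⇛ v × u ⇛ v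
  peak-root {ℓ} {r} {m = m} {u} rule σ e p with decompose ℓ (linear rule) (subst (_⇉[ m ] u) e p)
  ... | overlapping ov p' _ =
    _ , (_ , _ , _ , overlap-closed linear cpc rule ov , p' , ε) , ∼⇒⇛ ε
  ... | inside τ k h u≡ _ =
    _ , ⇉⇒⇛ (parallel-subst r λ x x∈ → h x (varCond R rule x x∈)) , ⇉⇒⇛ (∥rule rule τ u≡ refl)

  mutual
    peak : ∀ {s t u n m} → s ⇉[ n ] t → s ⇉[ m ] u → ∃[ v ] t ⇛ v × u ⇛ v
    peak (∥rule rule σ e refl) q = peak-root rule σ e q
    peak p (∥rule rule σ e refl) with peak-root rule σ e p
    ... | v , u⇛v , t⇛v = v , t⇛v , u⇛v
    peak ∥var ∥var = _ , ∼⇒⇛ ε , ∼⇒⇛ ε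
    peak (∥con ps) (∥con qs) with peaks ps qs
    ... | _ , ts⇛ , us⇛ = _ , ⇛-con ts⇛ , ⇛-con us⇛

    peaks : ∀ {j n m} {ss ts us : Vec (Term F) j} → ss ⇉*[ n ] ts → ss ⇉*[ m ] us →
            ∃[ vs ] ts ⇛* vs × us ⇛* vs
    peaks [] [] = [] , ([] , _ , [] , ε , [] , ε) , ([] , _ , [] , ε , [] , ε)
    peaks (p ∷ ps) (q ∷ qs) with peak p q | peaks ps qs
    ... | _ , t⇛ , u⇛ | _ , ts⇛ , us⇛ = _ , ⇛*-∷ t⇛ ts⇛ , ⇛*-∷ u⇛ us⇛

  ∼-⇛ : ∀ {s t u} → s ∼ t → t ⇛ u → s ⇛ u
  ∼-⇛ s∼t (_ , _ , _ , l , p , r) = _ , _ , _ , s∼t ◅◅ l , p , r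

  diamond : ∀ {s t u} → s ⇛ t → s ⇛ u → ∃[ v ] t ⇛ v × u ⇛ v
  diamond (_ , _ , _ , s∼s₁ , p , t₁∼t) (_ , _ , _ , s∼s₂ , q , u₁∼u)
    with church-rosser (∼-sym s∼s₁ ◅◅ s∼s₂)
  -- First `p` is projected to a source `x` below `y`, hence below `s₂`: now one source `C`-reduces
  -- to the other, as `synchronize` requires.
  ... | _ , s₁↠y , s₂↠y with project-along (≺-wellFounded _) p s₁↠y
  ... | projection y↠x x⇉t₂ t₂∼t₁ _
    with synchronize (≺-wellFounded _) (≺-wellFounded _) (s₂↠y ◅◅ y↠x) q x⇉t₂
  ... | _ , _ , _ , _ , _ , z⇉u₂ , u₂∼u₁ , z⇉t₃ , t₃∼t₂ with peak z⇉t₃ z⇉u₂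
  ... | v , t₃⇛v , u₂⇛v = v , ∼-⇛ (∼-sym (t₃∼t₂ ◅◅ t₂∼t₁ ◅◅ t₁∼t)) t₃⇛v ,
                              ∼-⇛ (∼-sym (u₂∼u₁ ◅◅ u₁∼u)) u₂⇛v

  ⇛-confluent : Confluent _⇛_
  ⇛-confluent = diamond⇒confluent diamond

  -- The conversion in front of each parallel step is pushed behind it: both sides meet in `C`, the
  -- step is projected to a term reached from there, and `C`-steps are `R`-steps. One conversion
  -- remains at the end.
  ⇛*⇒↠∼ : ∀ {s t u} → s ∼ t → Star _⇛_ t u → ∃[ v ] s ↠R v × v ∼ u
  ⇛*⇒↠∼ s∼t ε = _ , ε , s∼t
  ⇛*⇒↠∼ s∼t ((_ , _ , _ , t∼t₁ , p , t₂∼t₃) ◅ t₃⇛*u) with church-rosser (s∼t ◅◅ t∼t₁)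
  ... | _ , s↠y , t₁↠y with project-along (≺-wellFounded _) p t₁↠y
  ... | projection y↠x x⇉t₄ t₄∼t₂ _ with ⇛*⇒↠∼ (t₄∼t₂ ◅◅ t₂∼t₃) t₃⇛*u
  ... | v , t₄↠v , v∼u = v , ↠C⇒↠R (s↠y ◅◅ y↠x) ◅◅ parallel⇒steps x⇉t₄ ◅◅ t₄↠v , v∼u

  step⇒⇛ : ∀ {s t} → Step R s t → s ⇛ t
  step⇒⇛ = ⇉⇒⇛ ∘ step⇒parallel ∘ fromStep R

  confluent : Confluent (Step R)
  confluent s↠t s↠u with ⇛-confluent (Star.map step⇒⇛ s↠t) (Star.map step⇒⇛ s↠u)
  ... | _ , t⇛*v , u⇛*v with ⇛*⇒↠∼ ε t⇛*v | ⇛*⇒↠∼ ε u⇛*v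
  -- What separates the two reducts is a conversion of `C`, so a join in `C` completes the diagram.
  ... | _ , t↠t' , t'∼v | _ , u↠u' , u'∼v with church-rosser (t'∼v ◅◅ ∼-sym u'∼v)
  ... | w , t'↠w , u'↠w = w , Star.map (toStep R) (t↠t' ◅◅ ↠C⇒↠R t'↠w) ,
                              Star.map (toStep R) (u↠u' ◅◅ ↠C⇒↠R u'↠w)

theorem3 : {o a b : Level} (F : Signature o) (R : TRS F a) (C : TRS F b) →
    LeftLinear R →
    CriticalPairClosing C R →
    StronglyNormalizing (RelStep (duplicating C) R) →
    Confluent (Step C) →
    Confluent (Step R)
theorem3 F R C = Confluence.confluent R C
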